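{- There exists a $2$-coloring of $\mathbb{N}$ for which there is no infinite set $B\subseteq\mathbb{N}$ such that $B+B+B$ is monochromatic.
   Context: $\mathbb{N}=\{1,2,3,\ldots\}$. For $B\subseteq\mathbb{N}$, $B+B+B=\{x+y+z:x,y,z\in B\}$, with repetitions among $x,y,z$ allowed. A $2$-coloring of $\mathbb{N}$ is a map from $\mathbb{N}$ to a two-element set; a subset is monochromatic if the coloring is constant on it. -}

module Defs where

open import Data.Fin.Base using (Fin)
open import Data.Irrelevant using (zipWith)
import Data.List.Membership.Propositional as List
open import Data.Nat.Base as ℕ using (ℕ; _>_)
open import Data.Nat.Properties using (+-mono-<)
open import Data.Product.Base using (∃-syntax; _×_)
open import Data.Refinement.Base using (Refinement-syntax; _,_)
open import Function.Bundles using (_⇔_)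
open import Level using (Level)
open import Relation.Binary.PropositionalEquality.Core using (_≡_)
open import Relation.Nullary.Negation.Core using (¬_)
open import Relation.Unary using (Pred; _∈_)

private
  variable
    a ℓ : Level

-- The positivity proof is irrelevant, so _≡_ on ℕ⁺ is equality of the
-- underlying naturals.
ℕ⁺ : Set
ℕ⁺ = [ n ∈ ℕ ∣ n > 0 ]

infixl 6 _+_

_+_ : ℕ⁺ → ℕ⁺ → ℕ⁺
(m , m>0) + (n , n>0) = (m ℕ.+ n) , zipWith +-mono-< m>0 n>0

Finite : {A : Set a} → Pred A ℓ → Set _
Finite {A = A} P = ∃[ xs ] (∀ (x : A) → x ∈ P ⇔ x List.∈ xs)

-- As a hypothesis the bare negation is the weakest constructive form of
-- infinitude: it provides no enumeration of P and no bound-exceeding elements.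
Infinite : {A : Set a} → Pred A ℓ → Set _
Infinite P = ¬ Finite P

TripleSumset : Pred ℕ⁺ ℓ → Pred ℕ⁺ ℓ
TripleSumset B n =
  ∃[ x ] ∃[ y ] ∃[ z ] (x ∈ B × y ∈ B × z ∈ B × n ≡ x + y + z)

2-Coloring : Set
2-Coloring = ℕ⁺ → Fin 2

Monochromatic : 2-Coloring → Pred ℕ⁺ ℓ → Set _
Monochromatic c S = ∀ m n → m ∈ S → n ∈ S → c m ≡ c n

{-# OPTIONS --safe #-}
module Submission where

-- Color n by the parity of the binary logarithm ⌊log₂ n⌋.
--
-- Suppose x, y ∈ B with 4x ≤ y, and consider the three elements
--   p = x + x + y,   q = x + y + y,   r = y + y + y
-- of B + B + B.  Each of q ≤ 2p and r ≤ 2q holds, so the logarithm grows by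
-- at most one in each of the steps p, q, r.  If the three colors agree, it
-- cannot grow by exactly one, so it is constant along p, q, r
-- (`same-color⇒same-log`).  But 4x ≤ y means 2p ≤ r, so the logarithm of r
-- exceeds that of p: a contradiction (`no-spread`).
--
-- Hence, if B + B + B is monochromatic, a member x of B bounds all of B by 4x.
-- A bounded set is finite up to double negation (`bounded⇒¬¬finite`), so an
-- infinite B would have no members at all, and then it would be finite.

open import Defs
open import Data.Empty using (⊥-elim; ⊥-elim-irr)
open import Data.Fin.Base using (toℕ)
open import Data.Fin.Properties using (toℕ-fromℕ<)
open import Data.Irrelevant using ([_])
open import Data.List.Base using (List; []; _∷_; map; upTo)
import Data.List.Membership.Propositional as List
open import Data.List.Membership.Propositional.Properties using (∈-map⁺; ∈-upTo⁺)
open import Data.List.Relation.Unary.Any using (here; there)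
open import Data.Nat.Base as ℕ
  using (ℕ; zero; suc; _*_; _≤_; _<_; _%_; NonZero; z<s)
open import Data.Nat.DivMod using (_mod_; m%n<n)
open import Data.Nat.Logarithm using (⌊log₂_⌋; ⌊log₂⌋-mono-≤; ⌊log₂[2*b]⌋≡1+⌊log₂b⌋)
open import Data.Nat.Properties
  using (≤-trans; ≤-reflexive; ≤-antisym; <-irrefl; <⇒≤; ≰⇒>; m≤n⇒m<n∨m≡n;
         m≤m+n; +-monoˡ-≤; +-monoʳ-≤; module ≤-Reasoning)
open import Data.Nat.Tactic.RingSolver using (solve-∀)
open import Data.Product.Base using (Σ-syntax; _×_; _,_; proj₁; proj₂)
open import Data.Refinement.Base using (_,_; value)
open import Data.Sum.Base using (inj₁; inj₂)
open import Function.Base using (_∘_)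
open import Function.Bundles using (mk⇔; Equivalence)
open import Level using (0ℓ; Level)
open import Relation.Binary.PropositionalEquality
  using (_≡_; _≢_; refl; sym; trans; cong)
open import Relation.Nullary.Decidable.Core using (Dec; yes; no; ¬¬-excluded-middle)
open import Relation.Nullary.Negation.Core using (¬_)
open import Relation.Unary using (Pred; _∈_; _∩_)

private
  variable
    a ℓ : Level

-- Finiteness up to double negation

-- Membership in P is not assumed decidable, so the elements of P among ys can
-- be listed only under a double negation.
¬¬finite-∩-list : {A : Set a} (P : Pred A ℓ) (ys : List A) →
                  ¬ ¬ Finite (P ∩ (List._∈ ys))
¬¬finite-∩-list P [] k = k ([] , λ _ → mk⇔ proj₂ (λ ()))
¬¬finite-∩-list P (y ∷ ys) k =
  ¬¬-excluded-middle λ Py? → ¬¬finite-∩-list P ys λ fin → k (extend Py? fin)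
  where
  extend : Dec (P y) → Finite (P ∩ (List._∈ ys)) → Finite (P ∩ (List._∈ (y ∷ ys)))
  extend (yes Py) (xs , P∩ys⇔xs) = y ∷ xs , λ x → mk⇔
    (λ { (_  , here x≡y)   → here x≡y
       ; (Px , there x∈ys) → there (Equivalence.to (P∩ys⇔xs x) (Px , x∈ys)) })
    (λ { (here refl)  → Py , here refl
       ; (there x∈xs) → let Px , x∈ys = Equivalence.from (P∩ys⇔xs x) x∈xs
                        in Px , there x∈ys })
  extend (no ¬Py) (xs , P∩ys⇔xs) = xs , λ x → mk⇔
    (λ { (Px , here refl)  → ⊥-elim (¬Py Px)
       ; (Px , there x∈ys) → Equivalence.to (P∩ys⇔xs x) (Px , x∈ys) })
    (λ x∈xs → let Px , x∈ys = Equivalence.from (P∩ys⇔xs x) x∈xs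
              in Px , there x∈ys)

-- The positive integers 1, …, n.
oneTo : ℕ → List ℕ⁺
oneTo n = map (λ k → suc k , [ z<s ]) (upTo n)

∈-oneTo : ∀ {n} (x : ℕ⁺) → value x ≤ n → x List.∈ oneTo n
∈-oneTo (zero  , [ 0>0 ]) _   = ⊥-elim-irr (<-irrefl refl 0>0)
∈-oneTo (suc k , _)       k<n = ∈-map⁺ _ (∈-upTo⁺ k<n)

bounded⇒¬¬finite : (P : Pred ℕ⁺ ℓ) (n : ℕ) → (∀ x → x ∈ P → value x ≤ n) →
                   ¬ ¬ Finite P
bounded⇒¬¬finite P n P≤n k = ¬¬finite-∩-list P (oneTo n) λ (xs , P∩⇔xs) →
  k (xs , λ x → mk⇔
    (λ Px → Equivalence.to (P∩⇔xs x) (Px , ∈-oneTo x (P≤n x Px)))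
    (proj₁ ∘ Equivalence.from (P∩⇔xs x)))

-- The coloring

-- The color of n is the parity of ⌊log₂ n⌋.
logParity : 2-Coloring
logParity n = ⌊log₂ value n ⌋ mod 2

value-nonZero : (n : ℕ⁺) → NonZero (value n)
value-nonZero (zero  , [ 0>0 ]) = ⊥-elim-irr (<-irrefl refl 0>0)
value-nonZero (suc _ , _)       = _

log₂-double : (n : ℕ⁺) → ⌊log₂ (2 * value n) ⌋ ≡ suc ⌊log₂ value n ⌋
log₂-double n = ⌊log₂[2*b]⌋≡1+⌊log₂b⌋ (value n) {{value-nonZero n}}

suc-changes-parity : ∀ n → suc n % 2 ≢ n % 2
suc-changes-parity zero          ()
suc-changes-parity (suc zero)    ()
suc-changes-parity (suc (suc n)) = suc-changes-parity n

toℕ-mod : ∀ n → toℕ (n mod 2) ≡ n % 2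
toℕ-mod n = toℕ-fromℕ< (m%n<n n 2)

same-color⇒same-log : (m n : ℕ⁺) → value m ≤ value n → value n ≤ 2 * value m →
                      logParity m ≡ logParity n →
                      ⌊log₂ value n ⌋ ≡ ⌊log₂ value m ⌋
same-color⇒same-log m n m≤n n≤2m cm≡cn
  with m≤n⇒m<n∨m≡n (⌊log₂⌋-mono-≤ m≤n)
... | inj₂ lm≡ln = sym lm≡ln
... | inj₁ lm<ln = ⊥-elim (suc-changes-parity ⌊log₂ value m ⌋
    (trans (cong (_% 2) (sym ln≡1+lm)) (sym parity≡)))
  where
  ln≡1+lm : ⌊log₂ value n ⌋ ≡ suc ⌊log₂ value m ⌋
  ln≡1+lm = ≤-antisym
    (≤-trans (⌊log₂⌋-mono-≤ n≤2m) (≤-reflexive (log₂-double m))) lm<ln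

  parity≡ : ⌊log₂ value m ⌋ % 2 ≡ ⌊log₂ value n ⌋ % 2
  parity≡ = trans (sym (toℕ-mod ⌊log₂ value m ⌋))
    (trans (cong toℕ cm≡cn) (toℕ-mod ⌊log₂ value n ⌋))

-- Sets whose triple sumset is monochromatic

no-spread : (B : Pred ℕ⁺ ℓ) → Monochromatic logParity (TripleSumset B) →
            ∀ x y → x ∈ B → y ∈ B → ¬ (4 * value x ≤ value y)
no-spread B mono x y Bx By 4x≤y = <-irrefl (sym log-r≡log-p) log-p<log-r
  where
  open ≤-Reasoning
  p q r : ℕ⁺
  p = x + x + y
  q = x + y + y
  r = y + y + y

  Bp : p ∈ TripleSumset B
  Bp = x , x , y , Bx , Bx , By , refl
  Bq : q ∈ TripleSumset B
  Bq = x , y , y , Bx , By , By , refl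
  Br : r ∈ TripleSumset B
  Br = y , y , y , By , By , By , refl

  u v : ℕ
  u = value x
  v = value y

  u≤v : u ≤ v
  u≤v = ≤-trans (m≤m+n u (3 * u)) 4x≤y

  p≤q : value p ≤ value q
  p≤q = +-monoˡ-≤ v (+-monoʳ-≤ u u≤v)

  q≤r : value q ≤ value r
  q≤r = +-monoˡ-≤ v (+-monoˡ-≤ v u≤v)

  q≤2p : value q ≤ 2 * value p
  q≤2p = begin
    u ℕ.+ v ℕ.+ v                        ≤⟨ m≤m+n _ (3 * u) ⟩
    u ℕ.+ v ℕ.+ v ℕ.+ 3 * u              ≡⟨ regroup u v ⟩
    2 * (u ℕ.+ u ℕ.+ v)                  ∎
    where
    regroup : ∀ u v → u ℕ.+ v ℕ.+ v ℕ.+ 3 * u ≡ 2 * (u ℕ.+ u ℕ.+ v)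
    regroup = solve-∀

  r≤2q : value r ≤ 2 * value q
  r≤2q = begin
    v ℕ.+ v ℕ.+ v                        ≤⟨ m≤m+n _ (2 * u ℕ.+ v) ⟩
    v ℕ.+ v ℕ.+ v ℕ.+ (2 * u ℕ.+ v)      ≡⟨ regroup u v ⟩
    2 * (u ℕ.+ v ℕ.+ v)                  ∎
    where
    regroup : ∀ u v → v ℕ.+ v ℕ.+ v ℕ.+ (2 * u ℕ.+ v) ≡ 2 * (u ℕ.+ v ℕ.+ v)
    regroup = solve-∀

  2p≤r : 2 * value p ≤ value r
  2p≤r = begin
    2 * (u ℕ.+ u ℕ.+ v)                  ≡⟨ regroup u v ⟩
    4 * u ℕ.+ v ℕ.+ v                    ≤⟨ +-monoˡ-≤ v (+-monoˡ-≤ v 4x≤y) ⟩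
    v ℕ.+ v ℕ.+ v                        ∎
    where
    regroup : ∀ u v → 2 * (u ℕ.+ u ℕ.+ v) ≡ 4 * u ℕ.+ v ℕ.+ v
    regroup = solve-∀

  log-r≡log-p : ⌊log₂ value r ⌋ ≡ ⌊log₂ value p ⌋
  log-r≡log-p = trans
    (same-color⇒same-log q r q≤r r≤2q (mono q r Bq Br))
    (same-color⇒same-log p q p≤q q≤2p (mono p q Bp Bq))

  log-p<log-r : ⌊log₂ value p ⌋ < ⌊log₂ value r ⌋
  log-p<log-r = ≤-trans (≤-reflexive (sym (log₂-double p))) (⌊log₂⌋-mono-≤ 2p≤r)

mainTheorem5 : Σ[ c ∈ 2-Coloring ]
    ¬ (Σ[ B ∈ Pred ℕ⁺ 0ℓ ] (Infinite B × Monochromatic c (TripleSumset B)))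
mainTheorem5 = logParity , λ (B , infinite , mono) →
  let
    empty : ∀ x → ¬ (x ∈ B)
    empty x Bx = bounded⇒¬¬finite B (4 * value x)
      (λ y By → <⇒≤ (≰⇒> (no-spread B mono x y Bx By))) infinite
  in infinite ([] , λ x → mk⇔ (⊥-elim ∘ empty x) (λ ()))
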